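{- Let $\Phi=(D,\varphi)$ be a $\mathbb{T}$-gain digraph. Then every eigenvalue of $L(\Phi)$ and every eigenvalue of $Q(\Phi)$ has nonnegative real part.
   Context: A digraph $D=(V,\mathcal{A})$ has a finite vertex set $V=\{v_1,\dots,v_n\}$ and a set $\mathcal{A}$ of ordered pairs of distinct vertices, called arcs (no loops; at most one arc from $v_i$ to $v_j$ for each ordered pair; opposite arcs may both be present). The out-degree $\deg^+(v)$ is the number of arcs leaving $v$. Let $\mathbb{T}=\{z\in\mathbb{C}:|z|=1\}$. A $\mathbb{T}$-gain digraph is a pair $\Phi=(D,\varphi)$ with $\varphi:\mathcal{A}\to\mathbb{T}$ an arbitrary function. Its gain adjacency matrix $A(\Phi)$ has entries $A(\Phi)_{ij}=\varphi(v_i,v_j)$ if $(v_i,v_j)\in\mathcal{A}$ and $0$ otherwise. With $D^+=\operatorname{diag}(\deg^+(v_1),\dots,\deg^+(v_n))$, the Laplacian and signless Laplacian are $L(\Phi)=D^+-A(\Phi)$ and $Q(\Phi)=D^++A(\Phi)$. Eigenvalues are taken over $\mathbb{C}$. -}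

module Defs where

open import Algebra.Bundles.Raw using (RawRing)
import Algebra.Definitions.RawMonoid as RawMonoidDefs
open import Data.Bool.Base using (Bool; false; if_then_else_; T)
open import Data.Bool.Properties using (T?)
open import Data.Fin.Base using (Fin)
open import Data.Fin.Properties using (_≟_)
open import Data.Fin.Subset using (Subset; ∣_∣)
open import Data.Integer.Base using (+_)
open import Data.Nat.Base as ℕ using (ℕ)
import Data.Nat.Properties as ℕₚ
open import Data.Product.Base using (_×_; _,_; ∃; ∃-syntax; proj₁; proj₂)
open import Data.Rational.Base as ℚ using (ℚ; 0ℚ; 1ℚ; ½)
import Data.Rational.Properties as ℚₚ
open import Data.Rational.Solver using (module +-*-Solver)
open import Data.Vec.Base using (tabulate)
open import Data.Vec.Functional using (Vector)
open import Level using (0ℓ)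
open import Relation.Binary.PropositionalEquality
open import Relation.Nullary using (¬_; yes; no; does)

-- The real numbers, as the setoid of Cauchy sequences of rationals.

Cauchy : (ℕ → ℚ) → Set
Cauchy s = ∀ ε → 0ℚ ℚ.< ε → ∃[ N ] (∀ m n → N ℕ.≤ m → N ℕ.≤ n →
             ℚ.∣ s m ℚ.- s n ∣ ℚ.< ε)

record ℝ : Set where
  constructor mkℝ
  field
    seq    : ℕ → ℚ
    cauchy : Cauchy seq

open ℝ public

infix 4 _≈ʳ_ _≤ʳ_

_≈ʳ_ : ℝ → ℝ → Set
x ≈ʳ y = ∀ ε → 0ℚ ℚ.< ε → ∃[ N ] (∀ n → N ℕ.≤ n →
           ℚ.∣ seq x n ℚ.- seq y n ∣ ℚ.< ε)

_≤ʳ_ : ℝ → ℝ → Set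
x ≤ʳ y = ∀ ε → 0ℚ ℚ.< ε → ∃[ N ] (∀ n → N ℕ.≤ n →
           seq x n ℚ.< seq y n ℚ.+ ε)

module _ where
  open +-*-Solver

  half-pos : ∀ ε → 0ℚ ℚ.< ε → 0ℚ ℚ.< ½ ℚ.* ε
  half-pos ε 0<ε = subst (ℚ._< ½ ℚ.* ε) (ℚₚ.*-zeroʳ ½) (ℚₚ.*-monoʳ-<-pos ½ 0<ε)

  half+half : ∀ ε → ½ ℚ.* ε ℚ.+ ½ ℚ.* ε ≡ ε
  half+half ε = trans (sym (ℚₚ.*-distribʳ-+ ε ½ ½)) (ℚₚ.*-identityˡ ε)

  +-difference : ∀ a b c d → (a ℚ.+ b) ℚ.- (c ℚ.+ d) ≡ (a ℚ.- c) ℚ.+ (b ℚ.- d)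
  +-difference = solve 4 (λ a b c d → (a :+ b) :- (c :+ d) := (a :- c) :+ (b :- d)) refl

  neg-difference : ∀ a b → (ℚ.- a) ℚ.- (ℚ.- b) ≡ ℚ.- (a ℚ.- b)
  neg-difference = solve 2 (λ a b → (:- a) :- (:- b) := :- (a :- b)) refl

  *-difference : ∀ a b c d →
    (a ℚ.* b) ℚ.- (c ℚ.* d) ≡ a ℚ.* (b ℚ.- d) ℚ.+ d ℚ.* (a ℚ.- c)
  *-difference = solve 4 (λ a b c d →
    (a :* b) :- (c :* d) := a :* (b :- d) :+ d :* (a :- c)) refl

  telescope : ∀ a b → a ≡ b ℚ.+ (a ℚ.- b)
  telescope = solve 2 (λ a b → a := b :+ (a :- b)) refl

abstract

  const-cauchy : ∀ q → Cauchy (λ _ → q)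
  const-cauchy q ε 0<ε = 0 , λ _ _ _ _ →
    subst (λ r → ℚ.∣ r ∣ ℚ.< ε) (sym (ℚₚ.+-inverseʳ q)) 0<ε

  +-cauchy : ∀ s t → Cauchy s → Cauchy t → Cauchy (λ n → s n ℚ.+ t n)
  +-cauchy s t cs ct ε 0<ε
    with cs (½ ℚ.* ε) (half-pos ε 0<ε) | ct (½ ℚ.* ε) (half-pos ε 0<ε)
  ... | M , f | N , g = M ℕ.⊔ N , λ m n p q → begin-strict
      ℚ.∣ (s m ℚ.+ t m) ℚ.- (s n ℚ.+ t n) ∣
        ≡⟨ cong ℚ.∣_∣ (+-difference (s m) (t m) (s n) (t n)) ⟩
      ℚ.∣ (s m ℚ.- s n) ℚ.+ (t m ℚ.- t n) ∣
        ≤⟨ ℚₚ.∣p+q∣≤∣p∣+∣q∣ (s m ℚ.- s n) (t m ℚ.- t n) ⟩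
      ℚ.∣ s m ℚ.- s n ∣ ℚ.+ ℚ.∣ t m ℚ.- t n ∣
        <⟨ ℚₚ.+-mono-<
             (f m n (ℕₚ.m⊔n≤o⇒m≤o M N p) (ℕₚ.m⊔n≤o⇒m≤o M N q))
             (g m n (ℕₚ.m⊔n≤o⇒n≤o M N p) (ℕₚ.m⊔n≤o⇒n≤o M N q)) ⟩
      ½ ℚ.* ε ℚ.+ ½ ℚ.* ε
        ≡⟨ half+half ε ⟩
      ε ∎
    where open ℚₚ.≤-Reasoning

  neg-cauchy : ∀ s → Cauchy s → Cauchy (λ n → ℚ.- s n)
  neg-cauchy s cs ε 0<ε with cs ε 0<ε
  ... | N , f = N , λ m n p q → subst (ℚ._< ε)
    (sym (trans (cong ℚ.∣_∣ (neg-difference (s m) (s n))) (ℚₚ.∣-p∣≡∣p∣ (s m ℚ.- s n))))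
    (f m n p q)

  eventually-bounded : ∀ s → Cauchy s →
    ∃[ B ] (0ℚ ℚ.< B) × ∃[ N ] (∀ n → N ℕ.≤ n → ℚ.∣ s n ∣ ℚ.≤ B)
  eventually-bounded s cs with cs 1ℚ (ℚₚ.positive⁻¹ 1ℚ)
  ... | N , f = ℚ.∣ s N ∣ ℚ.+ 1ℚ
              , ℚₚ.+-mono-≤-< (ℚₚ.0≤∣p∣ (s N)) (ℚₚ.positive⁻¹ 1ℚ)
              , N , λ n p → begin
      ℚ.∣ s n ∣
        ≡⟨ cong ℚ.∣_∣ (telescope (s n) (s N)) ⟩
      ℚ.∣ s N ℚ.+ (s n ℚ.- s N) ∣
        ≤⟨ ℚₚ.∣p+q∣≤∣p∣+∣q∣ (s N) (s n ℚ.- s N) ⟩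
      ℚ.∣ s N ∣ ℚ.+ ℚ.∣ s n ℚ.- s N ∣
        ≤⟨ ℚₚ.+-monoʳ-≤ ℚ.∣ s N ∣ (ℚₚ.<⇒≤ (f n N p ℕₚ.≤-refl)) ⟩
      ℚ.∣ s N ∣ ℚ.+ 1ℚ ∎
    where open ℚₚ.≤-Reasoning

  scaled-tolerance : ∀ B → 0ℚ ℚ.< B → ∀ ε → 0ℚ ℚ.< ε → ∃[ δ ] (0ℚ ℚ.< δ) × (B ℚ.* δ ≡ ε)
  scaled-tolerance B 0<B ε 0<ε = B⁻¹ ℚ.* ε
    , subst (ℚ._< B⁻¹ ℚ.* ε) (ℚₚ.*-zeroʳ B⁻¹) (ℚₚ.*-monoʳ-<-pos B⁻¹ 0<ε)
    , trans (sym (ℚₚ.*-assoc B B⁻¹ ε))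
        (trans (cong (ℚ._* ε) (ℚₚ.*-inverseʳ B)) (ℚₚ.*-identityˡ ε))
    where
    instance
      B-pos : ℚ.Positive B
      B-pos = ℚ.positive 0<B
      B-nonZero : ℚ.NonZero B
      B-nonZero = ℚₚ.pos⇒nonZero B
    B⁻¹ : ℚ
    B⁻¹ = ℚ.1/ B
    instance
      B⁻¹-pos : ℚ.Positive B⁻¹
      B⁻¹-pos = ℚₚ.1/pos⇒pos B

  ∣*∣-bound : ∀ a u B δ → 0ℚ ℚ.< B → ℚ.∣ a ∣ ℚ.≤ B → ℚ.∣ u ∣ ℚ.< δ →
    ℚ.∣ a ℚ.* u ∣ ℚ.< B ℚ.* δ
  ∣*∣-bound a u B δ 0<B a≤B u<δ = begin-strict
      ℚ.∣ a ℚ.* u ∣          ≡⟨ ℚₚ.∣p*q∣≡∣p∣*∣q∣ a u ⟩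
      ℚ.∣ a ∣ ℚ.* ℚ.∣ u ∣    ≤⟨ ℚₚ.*-monoʳ-≤-nonNeg ℚ.∣ u ∣ {{ℚₚ.∣-∣-nonNeg u}} a≤B ⟩
      B ℚ.* ℚ.∣ u ∣          <⟨ ℚₚ.*-monoʳ-<-pos B {{ℚ.positive 0<B}} u<δ ⟩
      B ℚ.* δ ∎
    where open ℚₚ.≤-Reasoning

  *-difference-bound : ∀ a b c d B C δ η → 0ℚ ℚ.< B → 0ℚ ℚ.< C →
    ℚ.∣ a ∣ ℚ.≤ B → ℚ.∣ d ∣ ℚ.≤ C →
    ℚ.∣ a ℚ.- c ∣ ℚ.< η → ℚ.∣ b ℚ.- d ∣ ℚ.< δ →
    ℚ.∣ a ℚ.* b ℚ.- c ℚ.* d ∣ ℚ.< B ℚ.* δ ℚ.+ C ℚ.* η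
  *-difference-bound a b c d B C δ η 0<B 0<C a≤B d≤C ac<η bd<δ = begin-strict
      ℚ.∣ a ℚ.* b ℚ.- c ℚ.* d ∣
        ≡⟨ cong ℚ.∣_∣ (*-difference a b c d) ⟩
      ℚ.∣ a ℚ.* (b ℚ.- d) ℚ.+ d ℚ.* (a ℚ.- c) ∣
        ≤⟨ ℚₚ.∣p+q∣≤∣p∣+∣q∣ (a ℚ.* (b ℚ.- d)) (d ℚ.* (a ℚ.- c)) ⟩
      ℚ.∣ a ℚ.* (b ℚ.- d) ∣ ℚ.+ ℚ.∣ d ℚ.* (a ℚ.- c) ∣
        <⟨ ℚₚ.+-mono-< (∣*∣-bound a (b ℚ.- d) B δ 0<B a≤B bd<δ)
                       (∣*∣-bound d (a ℚ.- c) C η 0<C d≤C ac<η) ⟩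
      B ℚ.* δ ℚ.+ C ℚ.* η ∎
    where open ℚₚ.≤-Reasoning

  *-cauchy : ∀ s t → Cauchy s → Cauchy t → Cauchy (λ n → s n ℚ.* t n)
  *-cauchy s t cs ct ε 0<ε =
    let B , 0<B , M₁ , b = eventually-bounded s cs
        C , 0<C , N₁ , c = eventually-bounded t ct
        δ , 0<δ , Bδ≡    = scaled-tolerance B 0<B (½ ℚ.* ε) (half-pos ε 0<ε)
        η , 0<η , Cη≡    = scaled-tolerance C 0<C (½ ℚ.* ε) (half-pos ε 0<ε)
        M₂ , f           = cs η 0<η
        N₂ , g           = ct δ 0<δ
        M                = M₁ ℕ.⊔ M₂
        N                = N₁ ℕ.⊔ N₂
    in M ℕ.⊔ N , λ m n p q →
      let M≤m = ℕₚ.m⊔n≤o⇒m≤o M N p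
          N≤m = ℕₚ.m⊔n≤o⇒n≤o M N p
          M≤n = ℕₚ.m⊔n≤o⇒m≤o M N q
          N≤n = ℕₚ.m⊔n≤o⇒n≤o M N q
      in subst (ℚ.∣ s m ℚ.* t m ℚ.- s n ℚ.* t n ∣ ℚ.<_)
           (trans (cong₂ ℚ._+_ Bδ≡ Cη≡) (half+half ε))
           (*-difference-bound (s m) (t m) (s n) (t n) B C δ η 0<B 0<C
             (b m (ℕₚ.m⊔n≤o⇒m≤o M₁ M₂ M≤m))
             (c n (ℕₚ.m⊔n≤o⇒m≤o N₁ N₂ N≤n))
             (f m n (ℕₚ.m⊔n≤o⇒n≤o M₁ M₂ M≤m) (ℕₚ.m⊔n≤o⇒n≤o M₁ M₂ M≤n))
             (g m n (ℕₚ.m⊔n≤o⇒n≤o N₁ N₂ N≤m) (ℕₚ.m⊔n≤o⇒n≤o N₁ N₂ N≤n)))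

infixl 6 _+ʳ_ _-ʳ_
infixl 7 _*ʳ_
infix  8 -ʳ_

fromℚ : ℚ → ℝ
fromℚ q = mkℝ (λ _ → q) (const-cauchy q)

0ʳ 1ʳ : ℝ
0ʳ = fromℚ 0ℚ
1ʳ = fromℚ 1ℚ

_+ʳ_ : ℝ → ℝ → ℝ
x +ʳ y = mkℝ (λ n → seq x n ℚ.+ seq y n) (+-cauchy (seq x) (seq y) (cauchy x) (cauchy y))

-ʳ_ : ℝ → ℝ
-ʳ x = mkℝ (λ n → ℚ.- seq x n) (neg-cauchy (seq x) (cauchy x))

_-ʳ_ : ℝ → ℝ → ℝ
x -ʳ y = x +ʳ (-ʳ y)

_*ʳ_ : ℝ → ℝ → ℝ
x *ʳ y = mkℝ (λ n → seq x n ℚ.* seq y n) (*-cauchy (seq x) (seq y) (cauchy x) (cauchy y))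

record ℂ : Set where
  constructor _+i_
  field
    re : ℝ
    im : ℝ

open ℂ public

infix  4 _≈ᶜ_
infixl 6 _+ᶜ_ _-ᶜ_
infixl 7 _*ᶜ_
infix  8 -ᶜ_

_≈ᶜ_ : ℂ → ℂ → Set
z ≈ᶜ w = (re z ≈ʳ re w) × (im z ≈ʳ im w)

fromℝ : ℝ → ℂ
fromℝ x = x +i 0ʳ

0ᶜ 1ᶜ : ℂ
0ᶜ = fromℝ 0ʳ
1ᶜ = fromℝ 1ʳ

fromℕ : ℕ → ℂ
fromℕ n = fromℝ (fromℚ (+ n ℚ./ 1))

_+ᶜ_ : ℂ → ℂ → ℂ
z +ᶜ w = (re z +ʳ re w) +i (im z +ʳ im w)

-ᶜ_ : ℂ → ℂ
-ᶜ z = (-ʳ re z) +i (-ʳ im z)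

_-ᶜ_ : ℂ → ℂ → ℂ
z -ᶜ w = z +ᶜ (-ᶜ w)

_*ᶜ_ : ℂ → ℂ → ℂ
z *ᶜ w = (re z *ʳ re w -ʳ im z *ʳ im w) +i (re z *ʳ im w +ʳ im z *ʳ re w)

ℂ-rawRing : RawRing 0ℓ 0ℓ
ℂ-rawRing = record
  { Carrier = ℂ ; _≈_ = _≈ᶜ_
  ; _+_ = _+ᶜ_ ; _*_ = _*ᶜ_ ; -_ = -ᶜ_ ; 0# = 0ᶜ ; 1# = 1ᶜ
  }

open RawMonoidDefs (RawRing.+-rawMonoid ℂ-rawRing) public using (sum)

-- The modulus |z| = √((re z)² + (im z)²), given by its graph: r is the
-- nonnegative square root of (re z)² + (im z)².
infix 4 ∣_∣ᶜ≈_
∣_∣ᶜ≈_ : ℂ → ℝ → Set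
∣ z ∣ᶜ≈ r = (0ʳ ≤ʳ r) × (r *ʳ r ≈ʳ re z *ʳ re z +ʳ im z *ʳ im z)

𝕋 : Set
𝕋 = ∃[ z ] ∣ z ∣ᶜ≈ 1ʳ

Matrix : ℕ → Set
Matrix n = Fin n → Fin n → ℂ

diag : ∀ {n} → Vector ℂ n → Matrix n
diag d i j = if does (i ≟ j) then d i else 0ᶜ

infixl 6 _+ᴹ_ _-ᴹ_
infixl 7 _*ᵥ_

_+ᴹ_ _-ᴹ_ : ∀ {n} → Matrix n → Matrix n → Matrix n
(M +ᴹ N) i j = M i j +ᶜ N i j
(M -ᴹ N) i j = M i j -ᶜ N i j

_*ᵥ_ : ∀ {n} → Matrix n → Vector ℂ n → Vector ℂ n
(M *ᵥ x) i = sum (λ j → M i j *ᶜ x j)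

IsEigenvalue : ∀ {n} → Matrix n → ℂ → Set
IsEigenvalue M μ = ∃[ x ] (¬ (∀ i → x i ≈ᶜ 0ᶜ)) × (∀ i → (M *ᵥ x) i ≈ᶜ μ *ᶜ x i)

-- A digraph on the vertices v₁, …, vₙ, given by the indicator function of its
-- set of arcs.
record Digraph (n : ℕ) : Set where
  field
    arc      : Fin n → Fin n → Bool
    loopless : ∀ i → arc i i ≡ false

  Arc : Fin n → Fin n → Set
  Arc i j = T (arc i j)

  outNeighbours : Fin n → Subset n
  outNeighbours i = tabulate (arc i)

  deg⁺ : Fin n → ℕ
  deg⁺ i = ∣ outNeighbours i ∣

-- No relation is imposed between the gains of opposite arcs.
record 𝕋-GainDigraph (n : ℕ) : Set where
  field
    D : Digraph n

  open Digraph D public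

  field
    φ : ∀ i j → Arc i j → 𝕋

  A : Matrix n
  A i j with T? (arc i j)
  ... | yes a = proj₁ (φ i j a)
  ... | no  _ = 0ᶜ

  D⁺ : Matrix n
  D⁺ = diag (λ i → fromℕ (deg⁺ i))

  L : Matrix n
  L = D⁺ -ᴹ A

  Q : Matrix n
  Q = D⁺ +ᴹ A

{-# OPTIONS --safe #-}

-- Let M = D⁺ + B with B = ±A, and pair the i-th coordinate of M x = μ x with
-- conj xᵢ.  Each arc (i , j) contributes |Bᵢⱼ| = 1, so
-- 0 ≤ |xᵢ + Bᵢⱼ xⱼ|² = |xᵢ|² + |xⱼ|² + 2 Re (conj xᵢ Bᵢⱼ xⱼ); summing over the
-- arcs at a vertex i where |xᵢ|² is maximal gives 0 ≤ 2 (Re μ) |xᵢ|².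
-- As a maximal |xᵢ| cannot be located among real numbers, the inequality is
-- proved for the rational approximations of index m, with an error term ρᵢ
-- that tends to 0.  If Re μ ≤ -δ < 0, it forces x to vanish.
module Submission where

open import Defs
open import Data.Bool.Base using (Bool; true; false; if_then_else_; T)
open import Data.Bool.Properties using (T?; T-≡)
open import Data.Empty using (⊥-elim)
open import Data.Fin.Base using (Fin; zero; suc)
open import Data.Fin.Properties using (_≟_)
open import Data.Fin.Subset using (∣_∣)
open import Data.Integer.Base as ℤ using (+_)
import Data.Integer.Properties as ℤₚ
open import Data.Nat.Base as ℕ using (ℕ)
import Data.Nat.Properties as ℕₚ
open import Data.Product.Base using (_×_; _,_; ∃-syntax; proj₁; proj₂)
open import Data.Rational.Base as ℚ using (ℚ; 0ℚ; 1ℚ; ½)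
import Data.Rational.Properties as ℚₚ
open import Data.Rational.Solver using (module +-*-Solver)
import Data.Rational.Unnormalised.Base as ℚᵘ
import Data.Rational.Unnormalised.Properties as ℚᵘₚ
open import Data.Sum.Base using (inj₁; inj₂)
open import Data.Vec.Base using (tabulate)
open import Data.Vec.Functional using (Vector)
open import Algebra.Bundles using (CommutativeRing)
open import Algebra.Properties.Semiring.Sum (CommutativeRing.semiring ℚₚ.+-*-commutativeRing)
  using (sum-cong-≗; ∑-distrib-+; sum-replicate-zero; *-distribʳ-sum)
  renaming (sum to sumℚ)
open import Function.Base using (_∘_)
open import Function.Bundles using (Equivalence)
open import Relation.Binary.PropositionalEquality
open import Relation.Nullary using (¬_; yes; no; does)
open +-*-Solver using (solve; _:+_; _:*_; _:-_; :-_; _:=_; con)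

-- Squares and absolute values of rationals.

p≤∣p∣ : ∀ p → p ℚ.≤ ℚ.∣ p ∣
p≤∣p∣ p with ℚₚ.≤-total 0ℚ p
... | inj₁ 0≤p = ℚₚ.≤-reflexive (sym (ℚₚ.0≤p⇒∣p∣≡p 0≤p))
... | inj₂ p≤0 = ℚₚ.≤-trans p≤0 (ℚₚ.0≤∣p∣ p)

∣p∣²≡p² : ∀ p → ℚ.∣ p ∣ ℚ.* ℚ.∣ p ∣ ≡ p ℚ.* p
∣p∣²≡p² p with ℚₚ.∣p∣≡p∨∣p∣≡-p p
... | inj₁ eq = cong₂ ℚ._*_ eq eq
... | inj₂ eq = trans (cong₂ ℚ._*_ eq eq)
                  (solve 1 (λ p → :- p :* :- p := p :* p) refl p)

0≤p² : ∀ p → 0ℚ ℚ.≤ p ℚ.* p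
0≤p² p = subst (0ℚ ℚ.≤_) (∣p∣²≡p² p)
  (ℚₚ.nonNegative⁻¹ (ℚ.∣ p ∣ ℚ.* ℚ.∣ p ∣)
    {{ℚₚ.nonNeg*nonNeg⇒nonNeg ℚ.∣ p ∣ {{ℚₚ.∣-∣-nonNeg p}} ℚ.∣ p ∣ {{ℚₚ.∣-∣-nonNeg p}}}})

0≤p²+q² : ∀ p q → 0ℚ ℚ.≤ p ℚ.* p ℚ.+ q ℚ.* q
0≤p²+q² p q = ℚₚ.+-mono-≤ (0≤p² p) (0≤p² q)

p≤p+q : ∀ p {q} → 0ℚ ℚ.≤ q → p ℚ.≤ p ℚ.+ q
p≤p+q p {q} 0≤q = subst (ℚ._≤ p ℚ.+ q) (ℚₚ.+-identityʳ p) (ℚₚ.+-monoʳ-≤ p 0≤q)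

0<p*q : ∀ {p q} → 0ℚ ℚ.< p → 0ℚ ℚ.< q → 0ℚ ℚ.< p ℚ.* q
0<p*q {p} {q} 0<p 0<q =
  subst (ℚ._< p ℚ.* q) (ℚₚ.*-zeroʳ p) (ℚₚ.*-monoʳ-<-pos p {{ℚ.positive 0<p}} 0<q)

p²<ε²⇒∣p∣<ε : ∀ p ε → 0ℚ ℚ.< ε → p ℚ.* p ℚ.< ε ℚ.* ε → ℚ.∣ p ∣ ℚ.< ε
p²<ε²⇒∣p∣<ε p ε 0<ε p²<ε² = ℚₚ.≰⇒> λ ε≤∣p∣ → ℚₚ.<-irrefl refl (begin-strict
    p ℚ.* p              <⟨ p²<ε² ⟩
    ε ℚ.* ε              ≤⟨ ℚₚ.*-monoˡ-≤-nonNeg ε {{ℚₚ.pos⇒nonNeg ε {{ℚ.positive 0<ε}}}} ε≤∣p∣ ⟩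
    ε ℚ.* ℚ.∣ p ∣        ≤⟨ ℚₚ.*-monoʳ-≤-nonNeg ℚ.∣ p ∣ {{ℚₚ.∣-∣-nonNeg p}} ε≤∣p∣ ⟩
    ℚ.∣ p ∣ ℚ.* ℚ.∣ p ∣  ≡⟨ ∣p∣²≡p² p ⟩
    p ℚ.* p              ∎)
  where open ℚₚ.≤-Reasoning

-- `ℚ./` divides out a gcd and so does not compute for a variable `k`; among unnormalised fractions
-- the equation reduces to cross-multiplication.
suc/1 : ∀ k → + ℕ.suc k ℚ./ 1 ≡ 1ℚ ℚ.+ + k ℚ./ 1
suc/1 k = ℚₚ.toℚᵘ-injective (begin
    ℚ.toℚᵘ (+ ℕ.suc k ℚ./ 1)            ≈⟨ ℚₚ.toℚᵘ-fromℚᵘ (ℚᵘ.mkℚᵘ (+ ℕ.suc k) 0) ⟩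
    ℚᵘ.mkℚᵘ (+ ℕ.suc k) 0               ≈⟨ ℚᵘ.*≡* (cong (λ z → (+ 1 ℤ.+ z) ℤ.* + 1) (sym (ℤₚ.*-identityʳ (+ k)))) ⟩
    ℚᵘ.1ℚᵘ ℚᵘ.+ ℚᵘ.mkℚᵘ (+ k) 0         ≈⟨ ℚᵘₚ.+-congʳ ℚᵘ.1ℚᵘ (ℚₚ.toℚᵘ-fromℚᵘ (ℚᵘ.mkℚᵘ (+ k) 0)) ⟨
    ℚ.toℚᵘ 1ℚ ℚᵘ.+ ℚ.toℚᵘ (+ k ℚ./ 1)   ≈⟨ ℚₚ.toℚᵘ-homo-+ 1ℚ (+ k ℚ./ 1) ⟨
    ℚ.toℚᵘ (1ℚ ℚ.+ + k ℚ./ 1)           ∎)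
  where
  open ℚᵘₚ.≃-Reasoning

-- Maxima and sums of finite rational vectors.

-- The first argument serves only to exclude n = 0. The order of ℚ is decidable, which is why the
-- maximum is taken among approximations.
argmax : ∀ {n} → Fin n → (f : Vector ℚ n) → ∃[ i ] (∀ j → f j ℚ.≤ f i)
argmax {ℕ.suc ℕ.zero}    _ f = zero , λ { zero → ℚₚ.≤-refl }
argmax {ℕ.suc (ℕ.suc n)} _ f with argmax zero (f ∘ suc)
... | i , f≤fi with ℚₚ.≤-total (f zero) (f (suc i))
...   | inj₁ f₀≤fi = suc i , λ { zero → f₀≤fi ; (suc j) → f≤fi j }
...   | inj₂ fi≤f₀ = zero , λ { zero → ℚₚ.≤-refl ; (suc j) → ℚₚ.≤-trans (f≤fi j) fi≤f₀ }

sum-nonneg : ∀ {n} (f : Vector ℚ n) → (∀ j → 0ℚ ℚ.≤ f j) → 0ℚ ℚ.≤ sumℚ f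
sum-nonneg {ℕ.zero}  f 0≤f = ℚₚ.≤-refl
sum-nonneg {ℕ.suc n} f 0≤f = ℚₚ.+-mono-≤ (0≤f zero) (sum-nonneg (f ∘ suc) (0≤f ∘ suc))

sum-select : ∀ {n} (i : Fin n) (f : Vector ℚ n) →
  sumℚ (λ j → if does (i ≟ j) then f j else 0ℚ) ≡ f i
sum-select {ℕ.suc n} zero    f = trans (cong (f zero ℚ.+_) (sum-replicate-zero n)) (ℚₚ.+-identityʳ (f zero))
sum-select             (suc i) f = trans (ℚₚ.+-identityˡ _) (sum-select i (f ∘ suc))

indicator : Bool → ℚ
indicator b = if b then 1ℚ else 0ℚ

-- Spreads the out-degree over the vertices j, so that each arc receives its own share of the
-- diagonal term.
∣tabulate∣≡sum-indicator : ∀ {n} (p : Fin n → Bool) →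
  + ∣ tabulate p ∣ ℚ./ 1 ≡ sumℚ (indicator ∘ p)
∣tabulate∣≡sum-indicator {ℕ.zero}  p = refl
∣tabulate∣≡sum-indicator {ℕ.suc n} p with p zero
... | true  = trans (suc/1 ∣ tabulate (p ∘ suc) ∣) (cong (1ℚ ℚ.+_) (∣tabulate∣≡sum-indicator (p ∘ suc)))
... | false = trans (∣tabulate∣≡sum-indicator (p ∘ suc)) (sym (ℚₚ.+-identityˡ _))

-- Null sequences and the sign of a real number.

Eventually : (ℕ → Set) → Set
Eventually P = ∃[ N ] (∀ n → N ℕ.≤ n → P n)

eventually-map₂ : ∀ {P Q R : ℕ → Set} → (∀ n → P n → Q n → R n) →
  Eventually P → Eventually Q → Eventually R
eventually-map₂ f (M , p) (N , q) = M ℕ.⊔ N , λ n M⊔N≤n →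
  f n (p n (ℕₚ.m⊔n≤o⇒m≤o M N M⊔N≤n)) (q n (ℕₚ.m⊔n≤o⇒n≤o M N M⊔N≤n))

eventually-all : ∀ {n} {P : Fin n → ℕ → Set} →
  (∀ i → Eventually (P i)) → Eventually (λ m → ∀ i → P i m)
eventually-all {ℕ.zero}  p = 0 , λ _ _ ()
eventually-all {ℕ.suc n} p =
  eventually-map₂ (λ { _ p₀ ps zero → p₀ ; _ p₀ ps (suc i) → ps i })
    (p zero) (eventually-all (p ∘ suc))

-- `x ≈ʳ y` unfolds to `Null` of the difference of the two sequences, so the lemmas below apply to
-- equations between reals directly.
Null : (ℕ → ℚ) → Set
Null f = ∀ ε → 0ℚ ℚ.< ε → Eventually (λ n → ℚ.∣ f n ∣ ℚ.< ε)

null-cong : ∀ {f g} → (∀ n → f n ≡ g n) → Null f → Null g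
null-cong f≗g nf ε 0<ε with nf ε 0<ε
... | N , p = N , λ n N≤n → subst (λ q → ℚ.∣ q ∣ ℚ.< ε) (f≗g n) (p n N≤n)

null-0 : Null (λ _ → 0ℚ)
null-0 ε 0<ε = 0 , λ _ _ → 0<ε

null-+ : ∀ {f g} → Null f → Null g → Null (λ n → f n ℚ.+ g n)
null-+ {f} {g} nf ng ε 0<ε =
  eventually-map₂
    (λ n p q → ℚₚ.≤-<-trans (ℚₚ.∣p+q∣≤∣p∣+∣q∣ (f n) (g n))
                 (subst (_ ℚ.<_) (half+half ε) (ℚₚ.+-mono-< p q)))
    (nf (½ ℚ.* ε) (half-pos ε 0<ε)) (ng (½ ℚ.* ε) (half-pos ε 0<ε))

null-neg : ∀ {f} → Null f → Null (λ n → ℚ.- f n)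
null-neg {f} nf ε 0<ε with nf ε 0<ε
... | N , p = N , λ n N≤n → subst (ℚ._< ε) (sym (ℚₚ.∣-p∣≡∣p∣ (f n))) (p n N≤n)

-- One factor is a real because its Cauchy property supplies the eventual bound B; the other is then
-- required to be below ε / B.
null-* : ∀ (x : ℝ) {f} → Null f → Null (λ n → seq x n ℚ.* f n)
null-* x {f} nf ε 0<ε =
  let B , 0<B , bounded = eventually-bounded (seq x) (cauchy x)
      δ , 0<δ , Bδ≡ε    = scaled-tolerance B 0<B ε 0<ε
  in eventually-map₂
       (λ n b p → subst (_ ℚ.<_) Bδ≡ε (∣*∣-bound (seq x n) (f n) B δ 0<B b p))
       bounded (nf δ 0<δ)

null-sum : ∀ {n} {f : Fin n → ℕ → ℚ} → (∀ j → Null (f j)) → Null (λ m → sumℚ (λ j → f j m))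
null-sum {ℕ.zero}  nf = null-0
null-sum {ℕ.suc n} nf = null-+ (nf zero) (null-sum (nf ∘ suc))

-- Passes from |xᵢ|² to the real and imaginary parts without a square root: `u` is tested against
-- ε².
null-if-square-bounded : ∀ {f u : ℕ → ℚ} → (∀ n → f n ℚ.* f n ℚ.≤ u n) → Null u → Null f
null-if-square-bounded {f} {u} f²≤u nu ε 0<ε with nu (ε ℚ.* ε) (0<p*q 0<ε 0<ε)
... | N , p = N , λ n N≤n → p²<ε²⇒∣p∣<ε (f n) ε 0<ε
  (ℚₚ.≤-<-trans (f²≤u n) (ℚₚ.≤-<-trans (p≤∣p∣ (u n)) (p n N≤n)))

-- A Cauchy sequence can be compared with -2η once its tail is confined to a
-- window of width η, so the nonnegativity of a real is ¬¬-stable.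
nonNeg-if-not-negative : ∀ x →
  ¬ (∃[ δ ] (0ℚ ℚ.< δ) × Eventually (λ n → δ ℚ.≤ ℚ.- seq x n)) → 0ʳ ≤ʳ x
nonNeg-if-not-negative x ¬neg ε 0<ε
  with cauchy x (½ ℚ.* (½ ℚ.* ε)) (half-pos _ (half-pos ε 0<ε))
... | N , close with seq x N ℚₚ.≤? ℚ.- (½ ℚ.* ε)
...   | yes xN≤-½ε = ⊥-elim (¬neg (½ ℚ.* (½ ℚ.* ε) , half-pos _ (half-pos ε 0<ε) , N , λ n N≤n →
        begin
          ½ ℚ.* (½ ℚ.* ε)
            ≡⟨ solve 1 (λ η → η := (η :+ η) :- η) refl (½ ℚ.* (½ ℚ.* ε)) ⟩
          (½ ℚ.* (½ ℚ.* ε) ℚ.+ ½ ℚ.* (½ ℚ.* ε)) ℚ.- ½ ℚ.* (½ ℚ.* ε)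
            ≡⟨ cong (ℚ._- ½ ℚ.* (½ ℚ.* ε)) (half+half (½ ℚ.* ε)) ⟩
          ½ ℚ.* ε ℚ.- ½ ℚ.* (½ ℚ.* ε)
            ≤⟨ ℚₚ.+-mono-≤
                 (subst (ℚ._≤ ℚ.- seq x N) (solve 1 (λ h → :- (:- h) := h) refl (½ ℚ.* ε)) (ℚₚ.neg-antimono-≤ xN≤-½ε))
                 (ℚₚ.neg-antimono-≤ (ℚₚ.<⇒≤ (ℚₚ.≤-<-trans (p≤∣p∣ _) (close n N N≤n ℕₚ.≤-refl)))) ⟩
          ℚ.- seq x N ℚ.- (seq x n ℚ.- seq x N)
            ≡⟨ solve 2 (λ a b → :- b :- (a :- b) := :- a) refl (seq x n) (seq x N) ⟩
          ℚ.- seq x n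
            ∎))
        where open ℚₚ.≤-Reasoning
...   | no xN≰-½ε = N , λ n N≤n → begin-strict
          0ℚ
            ≡⟨ solve 1 (λ h → con 0ℚ := (:- h :- h) :+ (h :+ h)) refl (½ ℚ.* ε) ⟩
          (ℚ.- (½ ℚ.* ε) ℚ.- ½ ℚ.* ε) ℚ.+ (½ ℚ.* ε ℚ.+ ½ ℚ.* ε)
            ≡⟨ cong (ℚ.- (½ ℚ.* ε) ℚ.- ½ ℚ.* ε ℚ.+_) (half+half ε) ⟩
          (ℚ.- (½ ℚ.* ε) ℚ.- ½ ℚ.* ε) ℚ.+ ε
            <⟨ ℚₚ.+-monoˡ-< ε (ℚₚ.+-mono-< (ℚₚ.≰⇒> xN≰-½ε) (ℚₚ.neg-antimono-<
                 (ℚₚ.<-trans (ℚₚ.≤-<-trans (p≤∣p∣ _) (close N n ℕₚ.≤-refl N≤n)) ¼ε<½ε))) ⟩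
          (seq x N ℚ.- (seq x N ℚ.- seq x n)) ℚ.+ ε
            ≡⟨ cong (ℚ._+ ε) (solve 2 (λ a b → b :- (b :- a) := a) refl (seq x n) (seq x N)) ⟩
          seq x n ℚ.+ ε
            ∎
        where
        open ℚₚ.≤-Reasoning
        ¼ε<½ε : ½ ℚ.* (½ ℚ.* ε) ℚ.< ½ ℚ.* ε
        ¼ε<½ε = subst₂ ℚ._<_ (ℚₚ.+-identityʳ _) (half+half (½ ℚ.* ε))
          (ℚₚ.+-monoʳ-< (½ ℚ.* (½ ℚ.* ε)) (half-pos _ (half-pos ε 0<ε)))

-- The real inner product on ℂ, index by index.

-- Re (conj z · w)
⟨_,_⟩ : ℂ → ℂ → ℝ
⟨ z , w ⟩ = re z *ʳ re w +ʳ im z *ʳ im w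

⟨⟩-congʳ : ∀ z {v w} → v ≈ᶜ w → ⟨ z , v ⟩ ≈ʳ ⟨ z , w ⟩
⟨⟩-congʳ z {v} {w} (re≈ , im≈) = null-cong
  (λ n → solve 6 (λ a b c d e f → a :* (c :- e) :+ b :* (d :- f) :=
                                    (a :* c :+ b :* d) :- (a :* e :+ b :* f)) refl
           (seq (re z) n) (seq (im z) n) (seq (re v) n) (seq (im v) n) (seq (re w) n) (seq (im w) n))
  (null-+ (null-* (re z) re≈) (null-* (im z) im≈))

-- Arithmetic of reals acts termwise on sequences, so this and the following identities hold exactly
-- in ℚ at each index, with no tolerance.
⟨⟩-sum : ∀ {n} z (f : Vector ℂ n) m → seq ⟨ z , sum f ⟩ m ≡ sumℚ (λ j → seq ⟨ z , f j ⟩ m)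
⟨⟩-sum {ℕ.zero}  z f m =
  solve 2 (λ a b → a :* con 0ℚ :+ b :* con 0ℚ := con 0ℚ) refl (seq (re z) m) (seq (im z) m)
⟨⟩-sum {ℕ.suc n} z f m = trans
  (solve 6 (λ a b c d e f → a :* (c :+ e) :+ b :* (d :+ f) :=
                              (a :* c :+ b :* d) :+ (a :* e :+ b :* f)) refl
     (seq (re z) m) (seq (im z) m) (seq (re (f zero)) m) (seq (im (f zero)) m)
     (seq (re (sum (f ∘ suc))) m) (seq (im (sum (f ∘ suc))) m))
  (cong (seq ⟨ z , f zero ⟩ m ℚ.+_) (⟨⟩-sum z (f ∘ suc) m))

⟨⟩-distribʳ : ∀ z p q w m →
  seq ⟨ z , (p +ᶜ q) *ᶜ w ⟩ m ≡ seq ⟨ z , p *ᶜ w ⟩ m ℚ.+ seq ⟨ z , q *ᶜ w ⟩ m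
⟨⟩-distribʳ z p q w m =
  solve 8 (λ a b c d e f g h →
      a :* ((c :+ e) :* g :- (d :+ f) :* h) :+ b :* ((c :+ e) :* h :+ (d :+ f) :* g) :=
      (a :* (c :* g :- d :* h) :+ b :* (c :* h :+ d :* g)) :+
      (a :* (e :* g :- f :* h) :+ b :* (e :* h :+ f :* g))) refl
    (seq (re z) m) (seq (im z) m) (seq (re p) m) (seq (im p) m)
    (seq (re q) m) (seq (im q) m) (seq (re w) m) (seq (im w) m)

-- The terms with `im w` cancel, so only the real part of an eigenvalue survives the pairing.
⟨z,wz⟩≡re-w*⟨z,z⟩ : ∀ z w m → seq ⟨ z , w *ᶜ z ⟩ m ≡ seq (re w) m ℚ.* seq ⟨ z , z ⟩ m
⟨z,wz⟩≡re-w*⟨z,z⟩ z w m =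
  solve 4 (λ a b c d → a :* (c :* a :- d :* b) :+ b :* (c :* b :+ d :* a) :=
                         c :* (a :* a :+ b :* b)) refl
    (seq (re z) m) (seq (im z) m) (seq (re w) m) (seq (im w) m)

⟨⟩-vanishes : ∀ z b w m → seq (re b) m ≡ 0ℚ → seq (im b) m ≡ 0ℚ → seq ⟨ z , b *ᶜ w ⟩ m ≡ 0ℚ
⟨⟩-vanishes z b w m re≡0 im≡0 = trans
  (cong₂ (λ p q → seq (re z) m ℚ.* (p ℚ.* seq (re w) m ℚ.- q ℚ.* seq (im w) m) ℚ.+
                  seq (im z) m ℚ.* (p ℚ.* seq (im w) m ℚ.+ q ℚ.* seq (re w) m))
     re≡0 im≡0)
  (solve 4 (λ a b g h → a :* (con 0ℚ :* g :- con 0ℚ :* h) :+ b :* (con 0ℚ :* h :+ con 0ℚ :* g) :=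
                          con 0ℚ) refl
     (seq (re z) m) (seq (im z) m) (seq (re w) m) (seq (im w) m))

⟨⟩-diag : ∀ {n} (x : Vector ℂ n) (d : Fin n → ℕ) i j m →
  seq ⟨ x i , diag (fromℕ ∘ d) i j *ᶜ x j ⟩ m ≡
  (if does (i ≟ j) then (+ d i ℚ./ 1) ℚ.* seq ⟨ x i , x j ⟩ m else 0ℚ)
⟨⟩-diag x d i j m with does (i ≟ j)
... | true  = solve 5 (λ a b e g h → a :* (e :* g :- con 0ℚ :* h) :+ b :* (e :* h :+ con 0ℚ :* g) :=
                                       e :* (a :* g :+ b :* h)) refl
                (seq (re (x i)) m) (seq (im (x i)) m) (+ d i ℚ./ 1) (seq (re (x j)) m) (seq (im (x j)) m)
... | false = ⟨⟩-vanishes (x i) 0ᶜ (x j) m refl refl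

-- The inequality contributed by one pair of vertices.

-- Expands |z + b w|² using |b w|² = |b|² |w|². The factor |b|² is kept because at a fixed index it
-- need not equal 1.
∣z+bw∣²≥0 : ∀ z b w m →
  0ℚ ℚ.≤ (seq ⟨ z , b *ᶜ w ⟩ m ℚ.+ seq ⟨ z , b *ᶜ w ⟩ m) ℚ.+
         (seq ⟨ z , z ⟩ m ℚ.+ seq ⟨ b , b ⟩ m ℚ.* seq ⟨ w , w ⟩ m)
∣z+bw∣²≥0 z b w m = subst (0ℚ ℚ.≤_)
  (solve 6 (λ a a′ b b′ w w′ →
      (a :+ (b :* w :- b′ :* w′)) :* (a :+ (b :* w :- b′ :* w′)) :+
      (a′ :+ (b :* w′ :+ b′ :* w)) :* (a′ :+ (b :* w′ :+ b′ :* w)) :=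
      ((a :* (b :* w :- b′ :* w′) :+ a′ :* (b :* w′ :+ b′ :* w)) :+
       (a :* (b :* w :- b′ :* w′) :+ a′ :* (b :* w′ :+ b′ :* w))) :+
      ((a :* a :+ a′ :* a′) :+ (b :* b :+ b′ :* b′) :* (w :* w :+ w′ :* w′))) refl
    (seq (re z) m) (seq (im z) m) (seq (re b) m) (seq (im b) m) (seq (re w) m) (seq (im w) m))
  (0≤p²+q² (seq (re (z +ᶜ b *ᶜ w)) m) (seq (im (z +ᶜ b *ᶜ w)) m))

-- t stands for the approximation of |Bᵢⱼ|², which only tends to 1.
on-arc : ∀ β v w t → 0ℚ ℚ.≤ β ℚ.+ (v ℚ.+ t ℚ.* w) → w ℚ.≤ v →
  0ℚ ℚ.≤ β ℚ.+ (1ℚ ℚ.* (v ℚ.+ v) ℚ.+ w ℚ.* (t ℚ.- 1ℚ))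
on-arc β v w t 0≤ w≤v = begin
    0ℚ
      ≤⟨ 0≤ ⟩
    β ℚ.+ (v ℚ.+ t ℚ.* w)
      ≡⟨ solve 4 (λ β v w t → β :+ (v :+ t :* w) := (β :+ (v :+ w :* (t :- con 1ℚ))) :+ w) refl β v w t ⟩
    (β ℚ.+ (v ℚ.+ w ℚ.* (t ℚ.- 1ℚ))) ℚ.+ w
      ≤⟨ ℚₚ.+-monoʳ-≤ (β ℚ.+ (v ℚ.+ w ℚ.* (t ℚ.- 1ℚ))) w≤v ⟩
    (β ℚ.+ (v ℚ.+ w ℚ.* (t ℚ.- 1ℚ))) ℚ.+ v
      ≡⟨ solve 3 (λ β v s → (β :+ (v :+ s)) :+ v := β :+ (con 1ℚ :* (v :+ v) :+ s)) refl
           β v (w ℚ.* (t ℚ.- 1ℚ)) ⟩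
    β ℚ.+ (1ℚ ℚ.* (v ℚ.+ v) ℚ.+ w ℚ.* (t ℚ.- 1ℚ))
      ∎
  where open ℚₚ.≤-Reasoning

-- The expression of `on-arc` with indicator 0 in place of 1. Having one shape for both cases allows
-- a sum over all j.
off-arc : ∀ {β t} v w → β ≡ 0ℚ → t ≡ 0ℚ →
  0ℚ ℚ.≤ (β ℚ.+ β) ℚ.+ (0ℚ ℚ.* (v ℚ.+ v) ℚ.+ w ℚ.* (t ℚ.- 0ℚ))
off-arc v w refl refl = ℚₚ.≤-reflexive
  (solve 2 (λ v w → con 0ℚ := (con 0ℚ :+ con 0ℚ) :+ (con 0ℚ :* (v :+ v) :+ w :* (con 0ℚ :- con 0ℚ))) refl v w)

-- Eigenvalues of the degree matrix plus a matrix unimodular on the arcs.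

-- Off the arcs no error term is allowed for, so the entries vanish at every index;
-- stated on components because -ᶜ 0ᶜ and 0ᶜ carry different Cauchy proofs.
record UnimodularOn {n} (arc : Fin n → Fin n → Bool) (B : Matrix n) : Set where
  field
    normSq   : ∀ i j → ⟨ B i j , B i j ⟩ ≈ʳ fromℚ (indicator (arc i j))
    vanishes : ∀ i j → arc i j ≡ false → ∀ m → seq (re (B i j)) m ≡ 0ℚ × seq (im (B i j)) m ≡ 0ℚ

module _ {n} {arc : Fin n → Fin n → Bool} {B : Matrix n} (unimodular : UnimodularOn arc B) where

  open UnimodularOn unimodular

  private
    M : Matrix n
    M = diag (λ i → fromℕ ∣ tabulate (arc i) ∣) +ᴹ B

  module _ (x : Vector ℂ n) (μ : ℂ) (eigen : ∀ i → (M *ᵥ x) i ≈ᶜ μ *ᶜ x i) where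

    private
      u : Fin n → ℕ → ℚ
      u i = seq ⟨ x i , x i ⟩

      b : Fin n → Fin n → ℕ → ℚ
      b i j = seq ⟨ x i , B i j *ᶜ x j ⟩

      χ : Fin n → Fin n → ℚ
      χ i j = indicator (arc i j)

      σ : Fin n → Fin n → ℕ → ℚ
      σ i j m = u j m ℚ.* (seq ⟨ B i j , B i j ⟩ m ℚ.- χ i j)

      g : Fin n → ℕ → ℚ
      g i m = seq ⟨ x i , (M *ᵥ x) i ⟩ m ℚ.- seq ⟨ x i , μ *ᶜ x i ⟩ m

      -- Collects both errors: `g` because the eigenvalue equation holds only in the limit, doubled
      -- as the cross term of |xᵢ + Bᵢⱼ xⱼ|² is, and `σ` because |Bᵢⱼ|² only tends to its indicator.
      ρ : Fin n → ℕ → ℚ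
      ρ i m = (g i m ℚ.+ g i m) ℚ.+ sumℚ (λ j → σ i j m)

    ρ-null : ∀ i → Null (ρ i)
    ρ-null i = null-+ (null-+ g-null g-null)
                 (null-sum {f = σ i} (λ j → null-* ⟨ x j , x j ⟩ (normSq i j)))
      where
      g-null : Null (g i)
      g-null = ⟨⟩-congʳ (x i) {(M *ᵥ x) i} {μ *ᶜ x i} (eigen i)

    ⟨x,Mx⟩ : ∀ i m → seq ⟨ x i , (M *ᵥ x) i ⟩ m ≡
      sumℚ (χ i) ℚ.* u i m ℚ.+ sumℚ (λ j → b i j m)
    ⟨x,Mx⟩ i m = begin
      seq ⟨ x i , (M *ᵥ x) i ⟩ m
        ≡⟨ ⟨⟩-sum (x i) (λ j → M i j *ᶜ x j) m ⟩
      sumℚ (λ j → seq ⟨ x i , M i j *ᶜ x j ⟩ m)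
        ≡⟨ sum-cong-≗ (λ j → trans
             (⟨⟩-distribʳ (x i) (diag (fromℕ ∘ d) i j) (B i j) (x j) m)
             (cong (ℚ._+ b i j m) (⟨⟩-diag x d i j m))) ⟩
      sumℚ (λ j → (if does (i ≟ j) then e ℚ.* seq ⟨ x i , x j ⟩ m else 0ℚ) ℚ.+ b i j m)
        ≡⟨ ∑-distrib-+ (λ j → if does (i ≟ j) then e ℚ.* seq ⟨ x i , x j ⟩ m else 0ℚ) (λ j → b i j m) ⟩
      sumℚ (λ j → if does (i ≟ j) then e ℚ.* seq ⟨ x i , x j ⟩ m else 0ℚ) ℚ.+ sumℚ (λ j → b i j m)
        ≡⟨ cong (ℚ._+ sumℚ (λ j → b i j m)) (sum-select i (λ j → e ℚ.* seq ⟨ x i , x j ⟩ m)) ⟩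
      e ℚ.* u i m ℚ.+ sumℚ (λ j → b i j m)
        ≡⟨ cong (λ e → e ℚ.* u i m ℚ.+ sumℚ (λ j → b i j m)) (∣tabulate∣≡sum-indicator (arc i)) ⟩
      sumℚ (χ i) ℚ.* u i m ℚ.+ sumℚ (λ j → b i j m)
        ∎
      where
      open ≡-Reasoning
      d : Fin n → ℕ
      d k = ∣ tabulate (arc k) ∣
      e : ℚ
      e = + d i ℚ./ 1

    arc-estimate : ∀ i j m → u j m ℚ.≤ u i m →
      0ℚ ℚ.≤ (b i j m ℚ.+ b i j m) ℚ.+ (χ i j ℚ.* (u i m ℚ.+ u i m) ℚ.+ σ i j m)
    -- Generalising over the Boolean changes the two indicators only and keeps the equation that
    -- `vanishes` requires.
    arc-estimate i j m uj≤ui = cases (arc i j) refl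
      where
      B² : ℚ
      B² = seq ⟨ B i j , B i j ⟩ m
      cases : ∀ c → arc i j ≡ c → 0ℚ ℚ.≤ (b i j m ℚ.+ b i j m) ℚ.+
        (indicator c ℚ.* (u i m ℚ.+ u i m) ℚ.+ u j m ℚ.* (B² ℚ.- indicator c))
      cases true  _      = on-arc (b i j m ℚ.+ b i j m) (u i m) (u j m) B²
        (∣z+bw∣²≥0 (x i) (B i j) (x j) m) uj≤ui
      cases false no-arc = let re≡0 , im≡0 = vanishes i j no-arc m in
        off-arc (u i m) (u j m) (⟨⟩-vanishes (x i) (B i j) (x j) m re≡0 im≡0)
          (cong₂ (λ p q → p ℚ.* p ℚ.+ q ℚ.* q) re≡0 im≡0)

    -- The sum of `arc-estimate` over j is 2⟨xᵢ, M xᵢ⟩ + Σσ. Replacing ⟨xᵢ, M xᵢ⟩ by ⟨xᵢ, μ xᵢ⟩ =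
    -- (Re μ) uᵢ costs `g`, so this nonnegative sum equals ρᵢ + 2 (Re μ) uᵢ.
    vertex-estimate : ∀ i m → (∀ j → u j m ℚ.≤ u i m) →
      ℚ.- seq (re μ) m ℚ.* (u i m ℚ.+ u i m) ℚ.≤ ρ i m
    vertex-estimate i m max = begin
      ℚ.- seq (re μ) m ℚ.* (u i m ℚ.+ u i m)
        ≤⟨ p≤p+q _ (sum-nonneg t (λ j → arc-estimate i j m (max j))) ⟩
      ℚ.- seq (re μ) m ℚ.* (u i m ℚ.+ u i m) ℚ.+ sumℚ t
        ≡⟨ cong (ℚ.- seq (re μ) m ℚ.* (u i m ℚ.+ u i m) ℚ.+_) sum-t ⟩
      ℚ.- seq (re μ) m ℚ.* (u i m ℚ.+ u i m) ℚ.+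
        ((Σb ℚ.+ Σb) ℚ.+ (sumℚ (χ i) ℚ.* (u i m ℚ.+ u i m) ℚ.+ Σσ))
        ≡⟨ regroup (seq (re μ) m) (u i m) Σb (sumℚ (χ i)) Σσ ⟩
      (g′ ℚ.+ g′) ℚ.+ Σσ
        ≡⟨ cong (λ q → (q ℚ.+ q) ℚ.+ Σσ)
             (cong₂ ℚ._-_ (⟨x,Mx⟩ i m) (⟨z,wz⟩≡re-w*⟨z,z⟩ (x i) μ m)) ⟨
      ρ i m
        ∎
      where
      open ℚₚ.≤-Reasoning
      t : Vector ℚ n
      t j = (b i j m ℚ.+ b i j m) ℚ.+ (χ i j ℚ.* (u i m ℚ.+ u i m) ℚ.+ σ i j m)
      Σb Σσ g′ : ℚ
      Σb = sumℚ (λ j → b i j m)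
      Σσ = sumℚ (λ j → σ i j m)
      g′ = (sumℚ (χ i) ℚ.* u i m ℚ.+ Σb) ℚ.- seq (re μ) m ℚ.* u i m
      regroup : ∀ r v β c s →
        ℚ.- r ℚ.* (v ℚ.+ v) ℚ.+ ((β ℚ.+ β) ℚ.+ (c ℚ.* (v ℚ.+ v) ℚ.+ s)) ≡
        (((c ℚ.* v ℚ.+ β) ℚ.- r ℚ.* v) ℚ.+ ((c ℚ.* v ℚ.+ β) ℚ.- r ℚ.* v)) ℚ.+ s
      regroup = solve 5 (λ r v β c s →
        :- r :* (v :+ v) :+ ((β :+ β) :+ (c :* (v :+ v) :+ s)) :=
        (((c :* v :+ β) :- r :* v) :+ ((c :* v :+ β) :- r :* v)) :+ s) refl
      sum-t : sumℚ t ≡ (Σb ℚ.+ Σb) ℚ.+ (sumℚ (χ i) ℚ.* (u i m ℚ.+ u i m) ℚ.+ Σσ)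
      sum-t = trans (∑-distrib-+ (λ j → b i j m ℚ.+ b i j m) _) (cong₂ ℚ._+_
        (∑-distrib-+ (λ j → b i j m) (λ j → b i j m))
        (trans (∑-distrib-+ (λ j → χ i j ℚ.* (u i m ℚ.+ u i m)) (λ j → σ i j m))
          (cong (ℚ._+ Σσ) (sym (*-distribʳ-sum (u i m ℚ.+ u i m) (χ i))))))

    -- At a vertex k where uₖ is maximal, `vertex-estimate` yields δ uₖ ≤ ρₖ, and every other uᵢ
    -- lies below uₖ.
    normSq-null : ∀ δ → 0ℚ ℚ.< δ → Eventually (λ m → δ ℚ.≤ ℚ.- seq (re μ) m) → ∀ i → Null (u i)
    normSq-null δ 0<δ neg i ε 0<ε =
      -- The maximising vertex may change with m, so all ρₖ must be small at once. The tolerance δ ε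
      -- leaves ε after cancelling δ.
      eventually-map₂ bound neg (eventually-all (λ k → ρ-null k (δ ℚ.* ε) (0<p*q 0<δ 0<ε)))
      where
      open ℚₚ.≤-Reasoning
      0≤u : ∀ k m → 0ℚ ℚ.≤ u k m
      0≤u k m = 0≤p²+q² (seq (re (x k)) m) (seq (im (x k)) m)
      module _ (m : ℕ) (δ≤ : δ ℚ.≤ ℚ.- seq (re μ) m) where
        bound-at-max : ∀ k → (∀ j → u j m ℚ.≤ u k m) → ℚ.∣ ρ k m ∣ ℚ.< δ ℚ.* ε → u k m ℚ.< ε
        bound-at-max k max small = ℚₚ.*-cancelˡ-<-nonNeg δ {{ℚₚ.pos⇒nonNeg δ {{ℚ.positive 0<δ}}}} (begin-strict
          δ ℚ.* u k m
            ≤⟨ ℚₚ.*-monoˡ-≤-nonNeg δ {{ℚₚ.pos⇒nonNeg δ {{ℚ.positive 0<δ}}}} (p≤p+q (u k m) (0≤u k m)) ⟩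
          δ ℚ.* (u k m ℚ.+ u k m)
            ≤⟨ ℚₚ.*-monoʳ-≤-nonNeg (u k m ℚ.+ u k m)
                 {{ℚ.nonNegative (ℚₚ.+-mono-≤ (0≤u k m) (0≤u k m))}} δ≤ ⟩
          ℚ.- seq (re μ) m ℚ.* (u k m ℚ.+ u k m)
            ≤⟨ vertex-estimate k m max ⟩
          ρ k m
            ≤⟨ p≤∣p∣ (ρ k m) ⟩
          ℚ.∣ ρ k m ∣
            <⟨ small ⟩
          δ ℚ.* ε
            ∎)
        bound : (∀ k → ℚ.∣ ρ k m ∣ ℚ.< δ ℚ.* ε) → ℚ.∣ u i m ∣ ℚ.< ε
        -- The given vertex `i` witnesses that the vertex set is nonempty.
        bound small = let k , max = argmax i (λ j → u j m) in begin-strict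
          ℚ.∣ u i m ∣  ≡⟨ ℚₚ.0≤p⇒∣p∣≡p (0≤u i m) ⟩
          u i m        ≤⟨ max i ⟩
          u k m        <⟨ bound-at-max k max (small k) ⟩
          ε            ∎

  -- That x is nonzero is known only as a negation and locates no nonzero coordinate. It can refute
  -- Re μ ≤ -δ, which suffices by `nonNeg-if-not-negative`.
  eigenvalue-re-nonNeg : ∀ μ → IsEigenvalue M μ → 0ʳ ≤ʳ re μ
  eigenvalue-re-nonNeg μ (x , x≉0 , eigen) = nonNeg-if-not-negative (re μ)
    λ (δ , 0<δ , neg) → x≉0 λ i →
      let u-null = normSq-null x μ eigen δ 0<δ neg i
          r      = seq (re (x i))
          s      = seq (im (x i))
      -- The goal `xᵢ ≈ᶜ 0ᶜ` subtracts 0 from each component; each squared component is at most uᵢ.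
      in null-cong (λ m → sym (ℚₚ.+-identityʳ (r m)))
           (null-if-square-bounded (λ m → p≤p+q (r m ℚ.* r m) (0≤p² (s m))) u-null)
       , null-cong (λ m → sym (ℚₚ.+-identityʳ (s m)))
           (null-if-square-bounded (λ m → subst (s m ℚ.* s m ℚ.≤_) (ℚₚ.+-comm (s m ℚ.* s m) (r m ℚ.* r m))
                                            (p≤p+q (s m ℚ.* s m) (0≤p² (r m)))) u-null)

-- The gain matrix and its negative.

≈ʳ-sym : ∀ {x y} → x ≈ʳ y → y ≈ʳ x
≈ʳ-sym {x} {y} x≈y = null-cong
  (λ n → solve 2 (λ a b → :- (a :- b) := b :- a) refl (seq x n) (seq y n)) (null-neg x≈y)

A-unimodular : ∀ {n} (Φ : 𝕋-GainDigraph n) →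
  UnimodularOn (𝕋-GainDigraph.arc Φ) (𝕋-GainDigraph.A Φ)
A-unimodular Φ = record { normSq = normSq ; vanishes = vanishes }
  where
  open 𝕋-GainDigraph Φ
  normSq : ∀ i j → ⟨ A i j , A i j ⟩ ≈ʳ fromℚ (indicator (arc i j))
  normSq i j with T? (arc i j)
  -- The rewrite turns the indicator into 1. Membership in `𝕋` provides 1 · 1 ≈ |z|², and 1 · 1
  -- evaluates to 1 at every index.
  ... | yes a rewrite Equivalence.to T-≡ a = ≈ʳ-sym {1ʳ *ʳ 1ʳ} {⟨ proj₁ (φ i j a) , proj₁ (φ i j a) ⟩} (proj₂ (proj₂ (φ i j a)))
  ... | no ¬a with arc i j
  ...   | true  = ⊥-elim (¬a _)
  ...   | false = null-0
  vanishes : ∀ i j → arc i j ≡ false → ∀ m → seq (re (A i j)) m ≡ 0ℚ × seq (im (A i j)) m ≡ 0ℚ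
  vanishes i j arc≡false m with T? (arc i j)
  ... | yes a = ⊥-elim (subst T arc≡false a)
  ... | no  _ = refl , refl

neg-unimodular : ∀ {n} {arc : Fin n → Fin n → Bool} {B : Matrix n} →
  UnimodularOn arc B → UnimodularOn arc (λ i j → -ᶜ B i j)
neg-unimodular {B = B} unimodular = record
  { normSq   = λ i j → null-cong
      (λ m → cong (ℚ._- _) (solve 2 (λ a b → a :* a :+ b :* b := (:- a) :* (:- a) :+ (:- b) :* (:- b)) refl
                              (seq (re (B i j)) m) (seq (im (B i j)) m)))
      (normSq i j)
  ; vanishes = λ i j no-arc m → cong ℚ.-_ (proj₁ (vanishes i j no-arc m))
                              , cong ℚ.-_ (proj₂ (vanishes i j no-arc m))
  }
  where open UnimodularOn unimodular

theorem5p7 : (n : ℕ) (Φ : 𝕋-GainDigraph n) →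
    ((μ : ℂ) → IsEigenvalue (𝕋-GainDigraph.L Φ) μ → 0ʳ ≤ʳ re μ) ×
    ((μ : ℂ) → IsEigenvalue (𝕋-GainDigraph.Q Φ) μ → 0ʳ ≤ʳ re μ)
-- Subtraction in ℂ is defined as adding the negative, so `L` is `D⁺` plus the entrywise negative of
-- `A` by unfolding.
theorem5p7 n Φ = eigenvalue-re-nonNeg (neg-unimodular (A-unimodular Φ))
               , eigenvalue-re-nonNeg (A-unimodular Φ)
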